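{- There is an algorithm that, given the balanced parenthesis sequence $B$ of the $k^2$-tree of a binary matrix, detects all interchangeable subtrees of the $k^2$-tree (that is, determines the partition of the subtrees of height greater than $1$ into classes of mutually interchangeable subtrees) in time $O(|B|)$.
   Context: **$k^2$-tree.** Let $M$ be an $n\times n$ binary matrix, $n$ a power of $k$ (otherwise pad with zero rows and columns). The $k^2$-tree of $M$ is a $k^2$-ary tree of height $h=\log_k n$. The root (level $0$) represents $M$. A node at level $r<h$ represents a $k^{h-r}\times k^{h-r}$ submatrix. If that submatrix is all zeros the node is a leaf; otherwise the node is internal and has exactly $k^2$ children, in row-major order, representing the $k^2$ equal-sized square submatrices into which it is partitioned. All nodes at level $h$ are leaves and store single entries of $M$. **Balanced parenthesis sequence $B$.** Visit the tree in depth-first order, writing to $B$ an open parenthesis `(` when the visit of a node starts and a closed parenthesis `)` when it ends. However, at a level-$(h-1)$ node that is not a leaf, instead of visiting its children, write a pair `()` to $B$ and append the $k^2$ bits of its children to a separate bit vector $L'$. A subtree rooted at a node $u$ of level at most $h-1$ is identified by the position in $B$ of the open parenthesis written when the visit of $u$ starts. **Interchangeable subtrees.** Two subtrees $T_1,T_2$ of the $k^2$-tree of height greater than $1$ (a condition meant to exclude subtrees consisting of a single node) are interchangeable if the balanced parenthesis sequences generated for $T_1$ and for $T_2$ are identical, where these sequences are generated by the depth-first visit that writes `(` when the visit of a node starts and `)` when it ends, except that at a non-leaf node at level $h-1$ of the $k^2$-tree it writes a pair `()` instead of visiting the children. Time is measured in the standard unit-cost RAM model; $k$ and $n$ are regarded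 as known. -}

module Defs where

open import Data.Bool using (Bool; true; false; if_then_else_)
import Data.Bool as Bool
open import Data.Fin using (Fin; zero; toℕ; fromℕ<; combine; remQuot)
import Data.Fin.Properties as Fin
open import Data.List using (List; []; _∷_; _++_; [_]; concat; foldr; length; tabulate; take)
open import Data.Maybe using (Maybe; just; nothing)
open import Data.Nat using (ℕ; zero; suc; _+_; _∸_; _*_; _^_; _⊔_; _≤_; _<_; _≟_; _<?_)
open import Data.Nat.ListAction using (sum)
open import Data.Product using (_×_; proj₁; proj₂; ∃-syntax)
open import Function using (_⇔_)
open import Relation.Binary.PropositionalEquality using (_≡_)
open import Relation.Nullary using (Dec; yes; no; does)

Matrix : ℕ → Set
Matrix n = Fin n → Fin n → Bool

AllZero : ∀ {n} → Matrix n → Set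
AllZero M = ∀ i j → M i j ≡ false

allZero? : ∀ {n} (M : Matrix n) → Dec (AllZero M)
allZero? M = Fin.all? λ i → Fin.all? λ j → M i j Bool.≟ false

-- Zero rows are added at the bottom and zero columns on the right.
pad : ∀ {n m} → Matrix n → Matrix m
pad {n} M i j with toℕ i <? n | toℕ j <? n
... | yes i<n | yes j<n = M (fromℕ< i<n) (fromℕ< j<n)
... | yes _   | no _    = false
... | no _    | _       = false

-- h = ⌈log_k n⌉, i.e. k ^ h is the side length after padding; when n is
-- already a power of k there is no padding and h = log_k n.
IsCeilLog : (k n h : ℕ) → Set
IsCeilLog k n h = n ≤ k ^ h × (∀ j → n ≤ k ^ j → h ≤ j)

-- The index d is (height of the whole tree) − (level of the node), so that a
-- node of index d represents a k^d × k^d submatrix.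
data K2Tree (k : ℕ) : ℕ → Set where
  entry : Bool → K2Tree k 0
  zeros : ∀ {d} → K2Tree k (suc d)
  node  : ∀ {d} → (Fin (k * k) → K2Tree k d) → K2Tree k (suc d)

block : ∀ k {m} → Matrix (k * m) → Fin k → Fin k → Matrix m
block k M r c i j = M (combine r i) (combine c j)

-- remQuot splits the index c of a child as c = row * k + column, so the
-- children are in row-major order.
build : ∀ k d → Matrix (k ^ d) → K2Tree k d
build k zero    M = entry (M zero zero)
build k (suc d) M with allZero? M
... | yes _ = zeros
... | no _  = node λ c →
  build k d (block k M (proj₁ (remQuot {k} k c)) (proj₂ (remQuot {k} k c)))

k²-tree : ∀ k {n} h → Matrix n → K2Tree k h
k²-tree k h M = build k h (pad M)

height : ∀ {k d} → K2Tree k d → ℕ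
height (entry _) = 0
height zeros     = 0
height (node ts) = suc (foldr _⊔_ 0 (tabulate λ c → height (ts c)))

data Paren : Set where
  opening closing : Paren

-- Index 1 means level h − 1: the children of such a node are bits, which go
-- to L′ and leave no trace in the parenthesis sequence.
parens : ∀ {k d} → K2Tree k d → List Paren
parens (entry _)                   = opening ∷ closing ∷ []
parens zeros                       = opening ∷ closing ∷ []
parens {d = suc zero}    (node ts) = opening ∷ closing ∷ []
parens {d = suc (suc _)} (node ts) =
  opening ∷ concat (tabulate λ c → parens (ts c)) ++ [ closing ]

-- The nodes for which a pair of parentheses is written: those of level at
-- most h − 1 (and the root, if h = 0).  Hence the children of a node have to
-- be of index at least 1 here.
data Node {k : ℕ} : ∀ {d} → K2Tree k d → Set where
  root  : ∀ {d} {t : K2Tree k d} → Node t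
  child : ∀ {d} {ts : Fin (k * k) → K2Tree k (suc d)} →
          ∀ c → Node (ts c) → Node (node ts)

index : ∀ {k d} {t : K2Tree k d} → Node t → ℕ
index {d = d} root = d
index (child _ u)  = index u

subtree : ∀ {k d} {t : K2Tree k d} (u : Node t) → K2Tree k (index u)
subtree {t = t} root = t
subtree (child _ u)  = subtree u

-- The position (counted from 0) in parens t of the parenthesis opened at u:
-- inside a node, the sequence of child c is preceded by the opening
-- parenthesis of the node and by the sequences of the children before c.
position : ∀ {k d} {t : K2Tree k d} → Node t → ℕ
position root = 0
position (child {ts = ts} c u) =
  suc (sum (take (toℕ c) (tabulate λ i → length (parens (ts i)))) + position u)

Interchangeable : ∀ {k d e} → K2Tree k d → K2Tree k e → Set
Interchangeable t₁ t₂ = 1 < height t₁ × 1 < height t₂ × parens t₁ ≡ parens t₂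

-- An array f, indexed by the positions of the parenthesis sequence, describes
-- the partition into classes: the subtrees of height greater than 1 carry
-- class numbers between 1 and the length of the sequence, equal exactly for
-- interchangeable subtrees; every other position carries 0.
record DescribesClasses {k d} (t : K2Tree k d) (f : ℕ → ℕ) : Set where
  field
    marks   : ∀ p → p < length (parens t) →
              0 < f p ⇔ (∃[ u ] 1 < height (subtree {t = t} u) × position u ≡ p)
    bounded : ∀ p → p < length (parens t) → f p ≤ length (parens t)
    classes : ∀ (u v : Node t) → 1 < height (subtree u) → 1 < height (subtree v) →
              f (position u) ≡ f (position v) ⇔ Interchangeable (subtree u) (subtree v)

-- A unit-cost random access machine: natural-number registers r₀, r₁, … (a
-- program can name only finitely many of them), a random access memory of
-- natural-number cells, and no multiplication.
data Instr : Set where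
  const : (i c : ℕ) → Instr      -- rᵢ ← c
  add   : (i j l : ℕ) → Instr    -- rᵢ ← rⱼ + rₗ
  sub   : (i j l : ℕ) → Instr    -- rᵢ ← rⱼ ∸ rₗ
  load  : (i j : ℕ) → Instr      -- rᵢ ← mem[rⱼ]
  store : (i j : ℕ) → Instr      -- mem[rᵢ] ← rⱼ
  jump  : (a : ℕ) → Instr        -- go to instruction a
  jpos  : (i a : ℕ) → Instr      -- go to instruction a if rᵢ > 0

Program : Set
Program = List Instr

record State : Set where
  constructor state
  field
    pc   : ℕ
    regs : ℕ → ℕ
    mem  : ℕ → ℕ

_[_≔_] : (ℕ → ℕ) → ℕ → ℕ → (ℕ → ℕ)
(f [ i ≔ x ]) j = if does (j ≟ i) then x else f j

exec : Instr → State → State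
exec (const i c) (state pc r m) = state (suc pc) (r [ i ≔ c ]) m
exec (add i j l) (state pc r m) = state (suc pc) (r [ i ≔ r j + r l ]) m
exec (sub i j l) (state pc r m) = state (suc pc) (r [ i ≔ r j ∸ r l ]) m
exec (load i j)  (state pc r m) = state (suc pc) (r [ i ≔ m (r j) ]) m
exec (store i j) (state pc r m) = state (suc pc) r (m [ r i ≔ r j ])
exec (jump a)    (state pc r m) = state a r m
exec (jpos i a)  (state pc r m) with r i
... | zero  = state (suc pc) r m
... | suc _ = state a r m

fetch : Program → ℕ → Maybe Instr
fetch []      _       = nothing
fetch (x ∷ _) zero    = just x
fetch (_ ∷ P) (suc a) = fetch P a

-- Runs P s n s′: started in s, the program P executes exactly n instructions
-- and stops in s′.  It stops when the program counter leaves the program.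
data Runs (P : Program) : State → ℕ → State → Set where
  stop : ∀ {s} → fetch P (State.pc s) ≡ nothing → Runs P s 0 s
  step : ∀ {s x n s′} → fetch P (State.pc s) ≡ just x →
         Runs P (exec x s) n s′ → Runs P s (suc n) s′

bit : Paren → ℕ
bit opening = 1
bit closing = 0

-- The sequence occupies the cells 0, …, length B − 1; all other cells are 0.
inputMem : List Paren → ℕ → ℕ
inputMem []      _       = 0
inputMem (x ∷ _) zero    = bit x
inputMem (_ ∷ B) (suc a) = inputMem B a

inputRegs : (k n : ℕ) → List Paren → ℕ → ℕ
inputRegs k n B 0 = k
inputRegs k n B 1 = n
inputRegs k n B 2 = length B
inputRegs k n B _ = 0

initial : (k n : ℕ) → List Paren → State
initial k n B = state 0 (inputRegs k n B) (inputMem B)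

-- On termination r₀ holds the address of the output array.
output : State → ℕ → ℕ
output (state _ r m) p = m (r 0 + p)

{-# OPTIONS --safe #-}
-- The parenthesis sequence is read from right to left.  The forest to the right
-- of the current position, up to the end of the enclosing node, is either empty
-- or a first tree x followed by a forest f; hash-consing names it by a number
-- found in a table under the names of (the children of) x and of f.  A closing
-- parenthesis pushes the name of the current forest on a stack and starts with
-- the empty forest, named 0; an opening parenthesis outputs the current name,
-- pops the stack and looks up the pair, which takes constant time because
-- unused memory cells are 0.  The table is two-dimensional; as the machine
-- cannot multiply, the addresses of its rows are themselves tabulated.  A
-- subtree has height greater than 1 exactly if the forest below its root, as
-- written to B, is nonempty.
module Submission where

open import Defs
open import Data.Bool using (false; if_then_else_)
open import Data.Empty using (⊥; ⊥-elim)
open import Data.Fin using (Fin; zero; suc; toℕ; combine; remQuot)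
import Data.Fin.Properties as Fin
open import Data.List using (List; []; _∷_; _++_; [_]; concat; foldr; length; tabulate; take)
open import Data.List.Properties using (++-assoc; ++-identityʳ; ∷-injectiveʳ)
open import Data.Maybe using (just)
open import Data.Nat using (ℕ; zero; suc; _+_; _∸_; _*_; _^_; _⊔_; _≤_; _<_; z≤n; s≤s; _≟_)
open import Data.Nat.ListAction using (sum)
open import Data.Nat.Properties
open import Data.Nat.Solver using (module +-*-Solver)
open import Data.Product using (_×_; _,_; proj₁; proj₂; ∃-syntax)
open import Data.Sum using (_⊎_; inj₁; inj₂)
open import Data.Unit using (⊤; tt)
open import Function using (_∘_; _⇔_; mk⇔)
open import Relation.Binary.Definitions using (tri<; tri≈; tri>)
open import Relation.Binary.PropositionalEquality
  using (_≡_; _≢_; refl; sym; trans; cong; cong₂; subst; module ≡-Reasoning)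
open import Relation.Nullary using (¬_; yes; no)
open import Relation.Nullary.Decidable using (dec-true; dec-false)

-- Forests and their parenthesis sequences

infixr 5 _◃_ _⊕_

-- x ◃ f consists of a tree, given by the forest x of its children, and of f.
data Forest : Set where
  ε   : Forest
  _◃_ : (x f : Forest) → Forest

_⊕_ : Forest → Forest → Forest
ε       ⊕ g = g
(x ◃ f) ⊕ g = x ◃ (f ⊕ g)

⊕-identityʳ : ∀ f → f ⊕ ε ≡ f
⊕-identityʳ ε       = refl
⊕-identityʳ (x ◃ f) = cong (x ◃_) (⊕-identityʳ f)

render : Forest → List Paren → List Paren
render ε       zs = zs
render (x ◃ f) zs = opening ∷ render x (closing ∷ render f zs)

-- The position just after f, if f starts at position a.
end : Forest → ℕ → ℕ
end ε       a = a
end (x ◃ f) a = end f (suc (end x (suc a)))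

-- At f a p x: if f starts at position a, then at p a tree is opened whose
-- root has the children x.
data At : Forest → ℕ → ℕ → Forest → Set where
  here   : ∀ {x f a} → At (x ◃ f) a a x
  inside : ∀ {x f a p y} → At x (suc a) p y → At (x ◃ f) a p y
  after  : ∀ {x f a p y} → At f (suc (end x (suc a))) p y → At (x ◃ f) a p y

end-≤ : ∀ f a → a ≤ end f a
end-≤ ε       a = ≤-refl
end-≤ (x ◃ f) a = ≤-trans (n≤1+n a) (≤-trans (end-≤ x (suc a))
                    (≤-trans (n≤1+n _) (end-≤ f _)))

At-≥ : ∀ {f a p x} → At f a p x → a ≤ p
At-≥ here       = ≤-refl
At-≥ (inside q) = ≤-trans (n≤1+n _) (At-≥ q)
At-≥ {x ◃ f} {a} (after q) = ≤-trans (n≤1+n a) (≤-trans (end-≤ x (suc a))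
                               (≤-trans (n≤1+n _) (At-≥ q)))

At-< : ∀ {f a p x} → At f a p x → p < end f a
At-< {x ◃ f} {a} here = ≤-trans (end-≤ x (suc a)) (≤-trans (n≤1+n _) (end-≤ f _))
At-< {x ◃ f} (inside q) = ≤-trans (At-< q) (≤-trans (n≤1+n _) (end-≤ f _))
At-< (after q) = At-< q

length-render : ∀ f zs a → a + length (render f zs) ≡ end f a + length zs
length-render ε       zs a = refl
length-render (x ◃ f) zs a =
  trans (+-suc a _) (trans (length-render x _ (suc a))
    (trans (+-suc _ _) (length-render f zs _)))

-- An opening parenthesis after a forest would be parsed as one more tree of it.
NoOpening : List Paren → Set
NoOpening (opening ∷ _) = ⊥
NoOpening _             = ⊤

-- Parsing is deterministic: an opening parenthesis starts a tree, anything else ends the forest.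
-- The remainders are arbitrary so that the induction can enter a subtree, whose remainder begins
-- with `closing`.
render-unique : ∀ f g {xs ys} → NoOpening xs → NoOpening ys →
                render f xs ≡ render g ys → f ≡ g × xs ≡ ys
render-unique ε ε _ _ eq = refl , eq
render-unique ε (y ◃ g) nx _ refl = ⊥-elim nx
render-unique (x ◃ f) ε _ ny refl = ⊥-elim ny
render-unique (x ◃ f) (y ◃ g) nx ny eq
  with render-unique x y tt tt (∷-injectiveʳ eq)
... | refl , eq′ with render-unique f g nx ny (∷-injectiveʳ eq′)
...   | refl , eq″ = refl , eq″

-- The input in memory and array updates.

Holds : (ℕ → ℕ) → ℕ → List Paren → Set
Holds i a []       = ⊤
Holds i a (z ∷ zs) = i a ≡ bit z × Holds i (suc a) zs

Holds-end : ∀ {i} f {a zs} → Holds i a (render f zs) → Holds i (end f a) zs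
Holds-end ε       h       = h
Holds-end (x ◃ f) (_ , h) = Holds-end f (proj₂ (Holds-end x h))

inputMem-≥ : ∀ B {a} → length B ≤ a → inputMem B a ≡ 0
inputMem-≥ []      _       = refl
inputMem-≥ (x ∷ B) (s≤s l) = inputMem-≥ B l

Holds-∘suc : ∀ {i j a} zs → (∀ b → i (suc b) ≡ j b) → Holds j a zs → Holds i (suc a) zs
Holds-∘suc []       e h       = tt
Holds-∘suc (z ∷ zs) e (p , h) = trans (e _) p , Holds-∘suc zs e h

inputMem-Holds : ∀ B → Holds (inputMem B) 0 B
inputMem-Holds []      = tt
inputMem-Holds (x ∷ B) = refl , Holds-∘suc B (λ _ → refl) (inputMem-Holds B)

update-same : ∀ f i x → (f [ i ≔ x ]) i ≡ x
update-same f i x = cong (if_then x else f i) (dec-true (i ≟ i) refl)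

update-other : ∀ f {i j} x → j ≢ i → (f [ i ≔ x ]) j ≡ f j
update-other f {i} {j} x j≢i = cong (if_then x else f j) (dec-false (j ≟ i) j≢i)

-- The program and the composition of its runs.

prog : Program
prog =
  -- r₁ = 1, r₃ = S = length B + 1, r₅ = 2 S, r₄ = 3 S
  const 0 0 ∷ const 1 1 ∷ add 3 2 1 ∷ add 5 3 3 ∷ add 4 5 3 ∷ store 3 4 ∷
  -- 6: the loop; r₂ = position, r₆ = iterations so far, r₇ = class of the forest just read,
  -- r₅ = top of the stack, r₄ = address of row 3 + r₆
  jpos 2 8 ∷ jump 30 ∷
  sub 2 2 1 ∷ add 4 4 3 ∷ add 6 6 1 ∷ add 8 3 6 ∷ store 8 4 ∷ load 8 2 ∷ jpos 8 19 ∷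
  -- 15: closing parenthesis
  store 5 7 ∷ add 5 5 1 ∷ const 7 0 ∷ jump 6 ∷
  -- 19: opening parenthesis
  store 2 7 ∷ add 8 3 7 ∷ load 8 8 ∷ sub 5 5 1 ∷ load 9 5 ∷ add 8 8 9 ∷ load 7 8 ∷ jpos 7 6 ∷
  -- 27: the pair is new and is given the number r₆
  store 8 6 ∷ add 7 6 0 ∷ jump 6 ∷ []

-- `Runs` covers halting runs only, so a segment of a run is expressed by its effect on every run
-- that continues it.
record Reach (s : State) (τ : ℕ) (s′ : State) : Set where
  constructor via
  field extend : ∀ {n s″} → Runs prog s′ n s″ → Runs prog s (τ + n) s″

open Reach

Reach-trans : ∀ {s s′ s″ τ τ′} → Reach s τ s′ → Reach s′ τ′ s″ → Reach s (τ + τ′) s″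
Reach-trans {s} {τ = τ} {τ′} f g = via λ {n} {z} R →
  subst (λ i → Runs prog s i z) (sym (+-assoc τ τ′ n)) (extend f (extend g R))

-- Unlike the other instructions, `jpos` does not compute until its register is known to be zero or
-- a successor.
exec-jpos-zero : ∀ i {a pc r m} → r i ≡ 0 → exec (jpos i a) (state pc r m) ≡ state (suc pc) r m
exec-jpos-zero i {r = r} e with r i
exec-jpos-zero i refl | zero = refl

exec-jpos-suc : ∀ i {a pc r m x} → r i ≡ suc x → exec (jpos i a) (state pc r m) ≡ state a r m
exec-jpos-suc i {r = r} e with r i
exec-jpos-suc i refl | suc _ = refl

step-jpos-zero : ∀ {i a pc r m n s} → fetch prog pc ≡ just (jpos i a) → r i ≡ 0 →
                 Runs prog (state (suc pc) r m) n s → Runs prog (state pc r m) (suc n) s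
step-jpos-zero {i} {n = n} {s} f e R = step f (subst (λ z → Runs prog z n s) (sym (exec-jpos-zero i e)) R)

step-jpos-suc : ∀ {i a pc r m n s x} → fetch prog pc ≡ just (jpos i a) → r i ≡ suc x →
                Runs prog (state a r m) n s → Runs prog (state pc r m) (suc n) s
step-jpos-suc {i} {n = n} {s} f e R = step f (subst (λ z → Runs prog z n s) (sym (exec-jpos-suc i e)) R)

-- Memory layout and symbolic execution of the loop body.

module Machine (L : ℕ) (input : ℕ → ℕ) where

  S : ℕ
  S = suc L

  -- The memory is a table with rows of length S.  Row 0 holds the input and
  -- gradually the output, row 1 the address of row 3 + i in column i (a
  -- substitute for multiplication), row 2 the stack, and row 3 + x holds in
  -- column y the class of x ◃ y, or 0 if that class does not exist yet.
  cell : ℕ → ℕ → ℕ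
  cell zero    c = c
  cell (suc i) c = S + cell i c

  cell-+ : ∀ i c → cell i 0 + c ≡ cell i c
  cell-+ zero    c = refl
  cell-+ (suc i) c = trans (+-assoc S _ c) (cong (S +_) (cell-+ i c))

  -- Rows have length `L + 1`, so a column of at most `L` never reaches into the next row.
  cell-injective : ∀ i j {c e} → c ≤ L → e ≤ L → cell i c ≡ cell j e → i ≡ j × c ≡ e
  cell-injective zero    zero    _   _   eq = refl , eq
  cell-injective zero    (suc j) c≤L _   eq =
    ⊥-elim (<⇒≱ (s≤s c≤L) (≤-trans (m≤m+n S _) (≤-reflexive (sym eq))))
  cell-injective (suc i) zero    _   e≤L eq =
    ⊥-elim (<⇒≱ (s≤s e≤L) (≤-trans (m≤m+n S _) (≤-reflexive eq)))
  cell-injective (suc i) (suc j) c≤L e≤L eq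
    with cell-injective i j c≤L e≤L (+-cancelˡ-≡ S _ _ eq)
  ... | i≡j , c≡e = cong suc i≡j , c≡e

  other-row : ∀ m i j {c e} v → c ≤ L → e ≤ L → j ≢ i →
              (m [ cell i c ≔ v ]) (cell j e) ≡ m (cell j e)
  other-row m i j v c≤L e≤L j≢i =
    update-other m v λ eq → j≢i (proj₁ (cell-injective j i e≤L c≤L eq))

  other-column : ∀ m i j {c e} v → c ≤ L → e ≤ L → e ≢ c →
                 (m [ cell i c ≔ v ]) (cell j e) ≡ m (cell j e)
  other-column m i j v c≤L e≤L e≢c =
    update-other m v λ eq → e≢c (proj₂ (cell-injective j i e≤L c≤L eq))

  -- `p` is the position, `d` the height of the stack, `j` the number of iterations so far and `s`
  -- the current class; registers 8 and 9 are scratch.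
  record Regs (r : ℕ → ℕ) (p d j s : ℕ) : Set where
    field
      r₀ : r 0 ≡ 0
      r₁ : r 1 ≡ 1
      r₂ : r 2 ≡ p
      r₃ : r 3 ≡ S
      r₄ : r 4 ≡ cell (3 + j) 0
      r₅ : r 5 ≡ cell 2 d
      r₆ : r 6 ≡ j
      r₇ : r 7 ≡ s

  tableEntry : ℕ → (ℕ → ℕ) → ℕ → ℕ
  tableEntry j m = m [ cell 1 j ≔ cell (3 + j) 0 ]

  -- Shared by both kinds of parentheses. The address of row `3 + suc j` is tabulated here, in time
  -- for `suc j` to become a class.
  run-prefix : ∀ {r m p d j s} → Regs r (suc p) d j s →
    ∃[ r′ ] Reach (state 6 r m) 7 (state 14 r′ (tableEntry (suc j) m))
          × Regs r′ p d (suc j) s × r′ 8 ≡ tableEntry (suc j) m p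
  run-prefix {r} {m} {p} {d} {j} {s} R = r′ , reach , R′ , e₈
    where
    open Regs R
    m′ : ℕ → ℕ
    m′ = m [ r 3 + (r 6 + r 1) ≔ r 4 + r 3 ]
    r′ : ℕ → ℕ
    r′ = r [ 2 ≔ r 2 ∸ r 1 ] [ 4 ≔ r 4 + r 3 ] [ 6 ≔ r 6 + r 1 ]
           [ 8 ≔ r 3 + (r 6 + r 1) ] [ 8 ≔ m′ (r 2 ∸ r 1) ]
    e₂ : r 2 ∸ r 1 ≡ p
    e₂ = cong₂ _∸_ r₂ r₁
    e₆ : r 6 + r 1 ≡ suc j
    e₆ = trans (cong₂ _+_ r₆ r₁) (+-comm j 1)
    e₄ : r 4 + r 3 ≡ cell (3 + suc j) 0
    e₄ = trans (cong₂ _+_ r₄ r₃) (+-comm (cell (3 + j) 0) S)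
    eₘ : m′ ≡ tableEntry (suc j) m
    eₘ = cong₂ (λ a v → m [ a ≔ v ]) (cong₂ _+_ r₃ e₆) e₄
    e₈ : m′ (r 2 ∸ r 1) ≡ tableEntry (suc j) m p
    e₈ = cong₂ (λ f a → f a) eₘ e₂
    R′ : Regs r′ p d (suc j) s
    R′ = record { r₀ = r₀ ; r₁ = r₁ ; r₂ = e₂ ; r₃ = r₃ ; r₄ = e₄ ; r₅ = r₅ ; r₆ = e₆ ; r₇ = r₇ }
    reach : Reach (state 6 r m) 7 (state 14 r′ (tableEntry (suc j) m))
    reach = via λ {n} {z} Q → step-jpos-suc refl r₂
      (step refl (step refl (step refl (step refl (step refl (step refl
        (subst (λ f → Runs prog (state 14 r′ f) n z) (sym eₘ) Q)))))))

  run-closing : ∀ {r m p d j s} → Regs r p d j s → r 8 ≡ 0 →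
    ∃[ r′ ] Reach (state 14 r m) 5 (state 6 r′ (m [ cell 2 d ≔ s ])) × Regs r′ p (suc d) j 0
  run-closing {r} {m} {p} {d} {j} {s} R e₈ = r′ , reach , R′
    where
    open Regs R
    r′ : ℕ → ℕ
    r′ = r [ 5 ≔ r 5 + r 1 ] [ 7 ≔ 0 ]
    e₅ : r 5 + r 1 ≡ cell 2 (suc d)
    e₅ = trans (cong₂ _+_ r₅ r₁) (trans (+-comm _ 1)
           (trans (sym (+-suc S (S + d))) (cong (S +_) (sym (+-suc S d)))))
    R′ : Regs r′ p (suc d) j 0
    R′ = record { r₀ = r₀ ; r₁ = r₁ ; r₂ = r₂ ; r₃ = r₃ ; r₄ = r₄ ; r₅ = e₅ ; r₆ = r₆ ; r₇ = refl }
    reach : Reach (state 14 r m) 5 (state 6 r′ (m [ cell 2 d ≔ s ]))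
    reach = via λ {n} {z} Q → step-jpos-zero refl e₈ (step refl (step refl (step refl (step refl
      (subst (λ f → Runs prog (state 6 r′ f) n z)
             (sym (cong₂ (λ a v → m [ a ≔ v ]) r₅ r₇)) Q)))))

  -- Both memory hypotheses speak of the memory after cell `p` is overwritten, because the program
  -- outputs `s` before it looks up the row and pops `t`.
  module Opening {r m p d j s t} (R : Regs r p (suc d) j s) (e₈ : r 8 ≡ 1)
    (eₛ : (m [ p ≔ s ]) (cell 1 s) ≡ cell (3 + s) 0)
    (eₜ : (m [ p ≔ s ]) (cell 2 d) ≡ t) where

    open Regs R

    private
      m₁ m′ : ℕ → ℕ
      m₁ = m [ r 2 ≔ r 7 ]
      m′ = m [ p ≔ s ]
      r′ : ℕ → ℕ
      r′ = r [ 8 ≔ r 3 + r 7 ] [ 8 ≔ m₁ (r 3 + r 7) ] [ 5 ≔ r 5 ∸ r 1 ] [ 9 ≔ m₁ (r 5 ∸ r 1) ]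
             [ 8 ≔ m₁ (r 3 + r 7) + m₁ (r 5 ∸ r 1) ]
             [ 7 ≔ m₁ (m₁ (r 3 + r 7) + m₁ (r 5 ∸ r 1)) ]
      eₘ : m₁ ≡ m′
      eₘ = cong₂ (λ a v → m [ a ≔ v ]) r₂ r₇
      e₅ : r 5 ∸ r 1 ≡ cell 2 d
      e₅ = trans (cong₂ _∸_ r₅ r₁) (cong (_∸ 1)
             (trans (cong (S +_) (+-suc S d)) (+-suc S (S + d))))
      address : m₁ (r 3 + r 7) + m₁ (r 5 ∸ r 1) ≡ cell (3 + s) t
      address = trans (cong₂ _+_
        (trans (cong₂ (λ f a → f a) eₘ (cong₂ _+_ r₃ r₇)) eₛ)
        (trans (cong₂ (λ f a → f a) eₘ e₅) eₜ)) (cell-+ (3 + s) t)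
      e₇ : r′ 7 ≡ m′ (cell (3 + s) t)
      e₇ = cong₂ (λ f a → f a) eₘ address

    run-known : ∀ {i} → m′ (cell (3 + s) t) ≡ suc i →
      ∃[ r″ ] Reach (state 14 r m) 9 (state 6 r″ m′) × Regs r″ p d j (suc i)
    run-known {i} e = r′ , reach , R′
      where
      R′ : Regs r′ p d j (suc i)
      R′ = record { r₀ = r₀ ; r₁ = r₁ ; r₂ = r₂ ; r₃ = r₃ ; r₄ = r₄ ; r₅ = e₅ ; r₆ = r₆
                  ; r₇ = trans e₇ e }
      reach : Reach (state 14 r m) 9 (state 6 r′ m′)
      reach = via λ {n} {z} Q → step-jpos-suc refl e₈
        (step refl (step refl (step refl (step refl (step refl (step refl (step refl
        (step-jpos-suc refl (trans e₇ e) (subst (λ f → Runs prog (state 6 r′ f) n z) (sym eₘ) Q)))))))))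

    run-new : m′ (cell (3 + s) t) ≡ 0 →
      ∃[ r″ ] Reach (state 14 r m) 12 (state 6 r″ (m′ [ cell (3 + s) t ≔ j ])) × Regs r″ p d j j
    run-new e = r″ , reach , R″
      where
      r″ : ℕ → ℕ
      -- A register copy, since register 0 holds 0.
      r″ = r′ [ 7 ≔ r 6 + r 0 ]
      R″ : Regs r″ p d j j
      R″ = record { r₀ = r₀ ; r₁ = r₁ ; r₂ = r₂ ; r₃ = r₃ ; r₄ = r₄ ; r₅ = e₅ ; r₆ = r₆
                  ; r₇ = trans (cong₂ _+_ r₆ r₀) (+-identityʳ j) }
      reach : Reach (state 14 r m) 12 (state 6 r″ (m′ [ cell (3 + s) t ≔ j ]))
      reach = via λ {n} {z} Q → step-jpos-suc refl e₈
        (step refl (step refl (step refl (step refl (step refl (step refl (step refl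
        (step-jpos-zero refl (trans e₇ e) (step refl (step refl (step refl
        (subst (λ f → Runs prog (state 6 r″ f) n z)
          (sym (trans (cong (_[ address′ ≔ r 6 ]) eₘ) (cong₂ (λ a v → m′ [ a ≔ v ]) address r₆))) Q))))))))))))
        where
        address′ : ℕ
        address′ = m₁ (r 3 + r 7) + m₁ (r 5 ∸ r 1)

  -- The loop invariant and the meaning of class numbers.

  -- Each iteration consumes one token and creates at most one class, so `count` keeps all classes
  -- at most `L`, that is, valid columns. By `trie-inj` a nonzero class determines its pair.
  record Inv (m : ℕ → ℕ) (p j : ℕ) : Set where
    field
      count     : j + p ≡ L
      table     : ∀ i → i ≤ j → m (cell 1 i) ≡ cell (3 + i) 0
      unread    : ∀ q → q < p → m q ≡ input q
      trie-≤    : ∀ x s → s ≤ L → m (cell (3 + x) s) ≤ j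
      trie-inj  : ∀ x s y t {i} → s ≤ L → t ≤ L → m (cell (3 + x) s) ≡ suc i →
                  m (cell (3 + y) t) ≡ suc i → x ≡ y × s ≡ t

    j≤L : j ≤ L
    j≤L = ≤-trans (m≤m+n j p) (≤-reflexive count)

  -- Decodes classes into forests. Only `ε` has class 0, so a 0 in the table can mean a vacant cell.
  data Den (m : ℕ → ℕ) : ℕ → Forest → Set where
    den-ε : Den m 0 ε
    den-◃ : ∀ {x s i f g} → s ≤ L → m (cell (3 + x) s) ≡ suc i →
            Den m x f → Den m s g → Den m (suc i) (f ◃ g)

  Den-≤ : ∀ {m p j} → Inv m p j → ∀ {i f} → Den m i f → i ≤ j
  Den-≤ I den-ε = z≤n
  Den-≤ I (den-◃ {x} {s} s≤L e _ _) = subst (_≤ _) e (Inv.trie-≤ I x s s≤L)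

  -- A nonzero class occurs in only one table cell, whose row and column give back both components.
  Den-forest-unique : ∀ {m p j} → Inv m p j → ∀ {i f g} → Den m i f → Den m i g → f ≡ g
  Den-forest-unique I den-ε den-ε = refl
  Den-forest-unique I (den-◃ {x} {s} s≤ e Dx Ds) (den-◃ {y} {t} t≤ e′ Dy Dt)
    with Inv.trie-inj I x s y t s≤ t≤ e e′
  ... | refl , refl = cong₂ _◃_ (Den-forest-unique I Dx Dy) (Den-forest-unique I Ds Dt)

  -- By induction both derivations read the same table cell.
  Den-class-unique : ∀ {m i j f} → Den m i f → Den m j f → i ≡ j
  Den-class-unique den-ε den-ε = refl
  Den-class-unique (den-◃ _ e Dx Ds) (den-◃ _ e′ Dy Dt)
    with Den-class-unique Dx Dy | Den-class-unique Ds Dt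
  ... | refl | refl = trans (sym e) e′

  -- What a segment of the run leaves intact: occupied table cells, the stack below height `d`, and
  -- the output from position `b` on. Vacant table cells may be filled.
  record Frame (b d : ℕ) (m m′ : ℕ → ℕ) : Set where
    field
      grow  : ∀ x s i → s ≤ L → m (cell (3 + x) s) ≡ suc i → m′ (cell (3 + x) s) ≡ suc i
      stack : ∀ e → e < d → m′ (cell 2 e) ≡ m (cell 2 e)
      done  : ∀ q → b ≤ q → q ≤ L → m′ q ≡ m q

  Frame-refl : ∀ {b d m} → Frame b d m m
  Frame-refl = record { grow = λ _ _ _ _ e → e ; stack = λ _ _ → refl ; done = λ _ _ _ → refl }

  Frame-trans : ∀ {b d m m′ m″} → Frame b d m m′ → Frame b d m′ m″ → Frame b d m m″
  Frame-trans F G = record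
    { grow  = λ x s i l e → G.grow x s i l (F.grow x s i l e)
    ; stack = λ e l → trans (G.stack e l) (F.stack e l)
    ; done  = λ q l l′ → trans (G.done q l l′) (F.done q l l′) }
    where
    module F = Frame F
    module G = Frame G

  Frame-weaken : ∀ {b b′ d d′ m m′} → b ≤ b′ → d′ ≤ d → Frame b d m m′ → Frame b′ d′ m m′
  Frame-weaken b≤ d≤ F = record
    { grow  = F.grow
    ; stack = λ e l → F.stack e (≤-trans l d≤)
    ; done  = λ q l → F.done q (≤-trans b≤ l) }
    where module F = Frame F

  Den-mono : ∀ {b d m m′} → Frame b d m m′ → ∀ {i f} → Den m i f → Den m′ i f
  Den-mono F den-ε = den-ε
  Den-mono F (den-◃ {x} {s} {i} s≤ e Dx Ds) =
    den-◃ s≤ (Frame.grow F x s i s≤ e) (Den-mono F Dx) (Den-mono F Ds)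

  -- Effect of the individual writes on invariant and frame.

  tableEntry-Inv : ∀ {m p j} → Inv m (suc p) j → Inv (tableEntry (suc j) m) p (suc j)
  tableEntry-Inv {m} {p} {j} I = record
    { count    = count′
    ; table    = table′
    ; unread   = λ q q<p → trans (keep 0 (<⇒≤ (<-≤-trans q<p p≤L)) λ ()) (unread q (m≤n⇒m≤1+n q<p))
    ; trie-≤   = λ x s s≤ → subst (_≤ suc j) (sym (keep (3 + x) s≤ λ ())) (m≤n⇒m≤1+n (trie-≤ x s s≤))
    ; trie-inj = λ x s y t s≤ t≤ e e′ → trie-inj x s y t s≤ t≤
                   (trans (sym (keep (3 + x) s≤ λ ())) e) (trans (sym (keep (3 + y) t≤ λ ())) e′) }
    where
    open Inv I
    count′ : suc j + p ≡ L
    count′ = trans (sym (+-suc j p)) count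
    sj≤L : suc j ≤ L
    sj≤L = ≤-trans (m≤m+n (suc j) p) (≤-reflexive count′)
    p≤L : p ≤ L
    p≤L = ≤-trans (m≤n+m p (suc j)) (≤-reflexive count′)
    keep : ∀ i {c} → c ≤ L → i ≢ 1 → tableEntry (suc j) m (cell i c) ≡ m (cell i c)
    keep i c≤ = other-row m 1 i _ sj≤L c≤
    table′ : ∀ i → i ≤ suc j → tableEntry (suc j) m (cell 1 i) ≡ cell (3 + i) 0
    table′ i i≤ with m≤n⇒m<n∨m≡n i≤
    ... | inj₁ (s≤s i≤j) = trans (other-column m 1 1 _ sj≤L (≤-trans i≤ sj≤L) (<⇒≢ (s≤s i≤j))) (table i i≤j)
    ... | inj₂ refl      = update-same m _ _

  tableEntry-Frame : ∀ {b d m j} → j ≤ L → d ≤ L → Frame b d m (tableEntry j m)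
  tableEntry-Frame {m = m} {j} j≤ d≤ = record
    { grow  = λ x s i s≤ e → trans (keep (3 + x) s≤ λ ()) e
    ; stack = λ e e<d → keep 2 (≤-trans (<⇒≤ e<d) d≤) λ ()
    ; done  = λ q _ q≤ → keep 0 q≤ λ () }
    where
    keep : ∀ i {c} → c ≤ L → i ≢ 1 → tableEntry j m (cell i c) ≡ m (cell i c)
    keep i c≤ = other-row m 1 i _ j≤ c≤

  push-Inv : ∀ {m p j d s} → d ≤ L → Inv m p j → Inv (m [ cell 2 d ≔ s ]) p j
  push-Inv {m} {p} {j} {d} {s} d≤ I = record
    { count    = count
    ; table    = λ i i≤ → trans (keep 1 (≤-trans i≤ j≤L) λ ()) (table i i≤)
    ; unread   = λ q q<p → trans (keep 0 (<⇒≤ (<-≤-trans q<p p≤L)) λ ()) (unread q q<p)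
    ; trie-≤   = λ x t t≤ → subst (_≤ j) (sym (keep (3 + x) t≤ λ ())) (trie-≤ x t t≤)
    ; trie-inj = λ x a y b a≤ b≤ e e′ → trie-inj x a y b a≤ b≤
                   (trans (sym (keep (3 + x) a≤ λ ())) e) (trans (sym (keep (3 + y) b≤ λ ())) e′) }
    where
    open Inv I
    p≤L : p ≤ L
    p≤L = ≤-trans (m≤n+m p j) (≤-reflexive count)
    keep : ∀ i {c} → c ≤ L → i ≢ 2 → (m [ cell 2 d ≔ s ]) (cell i c) ≡ m (cell i c)
    keep i c≤ = other-row m 2 i s d≤ c≤

  push-Frame : ∀ {b d m s} → d ≤ L → Frame b d m (m [ cell 2 d ≔ s ])
  push-Frame {m = m} {s} d≤ = record
    { grow  = λ x t i t≤ e → trans (other-row m 2 (3 + x) s d≤ t≤ λ ()) e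
    ; stack = λ e e<d → other-column m 2 2 s d≤ (≤-trans (<⇒≤ e<d) d≤) (<⇒≢ e<d)
    ; done  = λ q _ q≤ → other-row m 2 0 s d≤ q≤ λ () }

  write-Inv : ∀ {m p j s} → Inv m p j → Inv (m [ p ≔ s ]) p j
  write-Inv {m} {p} {j} {s} I = record
    { count    = count
    ; table    = λ i i≤ → trans (keep 1 (≤-trans i≤ j≤L) λ ()) (table i i≤)
    ; unread   = λ q q<p → trans (update-other m s (<⇒≢ q<p)) (unread q q<p)
    ; trie-≤   = λ x t t≤ → subst (_≤ j) (sym (keep (3 + x) t≤ λ ())) (trie-≤ x t t≤)
    ; trie-inj = λ x a y b a≤ b≤ e e′ → trie-inj x a y b a≤ b≤
                   (trans (sym (keep (3 + x) a≤ λ ())) e) (trans (sym (keep (3 + y) b≤ λ ())) e′) }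
    where
    open Inv I
    p≤L : p ≤ L
    p≤L = ≤-trans (m≤n+m p j) (≤-reflexive count)
    keep : ∀ i {c} → c ≤ L → i ≢ 0 → (m [ p ≔ s ]) (cell i c) ≡ m (cell i c)
    keep i c≤ = other-row m 0 i s p≤L c≤

  write-Frame : ∀ {p d m s} → p ≤ L → d ≤ L → Frame (suc p) d m (m [ p ≔ s ])
  write-Frame {p} {m = m} {s} p≤ d≤ = record
    { grow  = λ x t i t≤ e → trans (other-row m 0 (3 + x) s p≤ t≤ λ ()) e
    ; stack = λ e e<d → other-row m 0 2 s p≤ (≤-trans (<⇒≤ e<d) d≤) λ ()
    ; done  = λ q p<q q≤ → update-other m s (>⇒≢ p<q) }

  -- The new class j has to exceed all the old ones, hence the hypothesis new
  -- instead of Inv.trie-≤, which allows j itself.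
  insert-Inv : ∀ {m p j x s} → s ≤ L → (new : ∀ y t → t ≤ L → m (cell (3 + y) t) < j) → Inv m p j →
               Inv (m [ cell (3 + x) s ≔ j ]) p j
  insert-Inv {m} {p} {j} {x} {s} s≤ new I = record
    { count    = count
    ; table    = λ i i≤ → trans (keep 1 (≤-trans i≤ j≤L) λ ()) (table i i≤)
    ; unread   = λ q q<p → trans (keep 0 (<⇒≤ (<-≤-trans q<p p≤L)) λ ()) (unread q q<p)
    ; trie-≤   = trie-≤′
    ; trie-inj = trie-inj′ }
    where
    open Inv I
    p≤L : p ≤ L
    p≤L = ≤-trans (m≤n+m p j) (≤-reflexive count)
    m′ : ℕ → ℕ
    m′ = m [ cell (3 + x) s ≔ j ]
    keep : ∀ i {c} → c ≤ L → i ≢ 3 + x → m′ (cell i c) ≡ m (cell i c)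
    keep i c≤ = other-row m (3 + x) i j s≤ c≤
    trie : ∀ y t → t ≤ L → (y ≡ x × t ≡ s × m′ (cell (3 + y) t) ≡ j)
                         ⊎ m′ (cell (3 + y) t) ≡ m (cell (3 + y) t)
    trie y t t≤ with y ≟ x | t ≟ s
    ... | yes refl | yes refl = inj₁ (refl , refl , update-same m _ _)
    ... | yes _    | no t≢s   = inj₂ (other-column m (3 + x) (3 + y) j s≤ t≤ t≢s)
    ... | no y≢x   | _        = inj₂ (keep (3 + y) t≤ λ { refl → y≢x refl })
    trie-≤′ : ∀ y t → t ≤ L → m′ (cell (3 + y) t) ≤ j
    trie-≤′ y t t≤ with trie y t t≤
    ... | inj₁ (_ , _ , e) = ≤-reflexive e
    ... | inj₂ e           = subst (_≤ j) (sym e) (trie-≤ y t t≤)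
    clash : ∀ {i} y t → t ≤ L → m (cell (3 + y) t) ≡ i → i ≢ j
    clash y t t≤ e refl = <⇒≢ (new y t t≤) e
    trie-inj′ : ∀ y t z u {i} → t ≤ L → u ≤ L → m′ (cell (3 + y) t) ≡ suc i →
                m′ (cell (3 + z) u) ≡ suc i → y ≡ z × t ≡ u
    trie-inj′ y t z u t≤ u≤ e e′ with trie y t t≤ | trie z u u≤
    ... | inj₁ (refl , refl , _) | inj₁ (refl , refl , _) = refl , refl
    -- The new cell holds `j` and all old entries are smaller, so the mixed cases are contradictory.
    ... | inj₁ (_ , _ , a) | inj₂ b = ⊥-elim (clash z u u≤ (trans (sym b) e′) (trans (sym e) a))
    ... | inj₂ a | inj₁ (_ , _ , b) = ⊥-elim (clash y t t≤ (trans (sym a) e) (trans (sym e′) b))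
    ... | inj₂ a | inj₂ b = trie-inj y t z u t≤ u≤ (trans (sym a) e) (trans (sym b) e′)

  insert-Frame : ∀ {b d m x s j} → s ≤ L → d ≤ L → m (cell (3 + x) s) ≡ 0 →
                 Frame b d m (m [ cell (3 + x) s ≔ j ])
  insert-Frame {m = m} {x} {s} {j} s≤ d≤ vacant = record
    { grow  = grow
    ; stack = λ e e<d → other-row m (3 + x) 2 j s≤ (≤-trans (<⇒≤ e<d) d≤) λ ()
    ; done  = λ q _ q≤ → other-row m (3 + x) 0 j s≤ q≤ λ () }
    where
    grow : ∀ y t i → t ≤ L → m (cell (3 + y) t) ≡ suc i →
           (m [ cell (3 + x) s ≔ j ]) (cell (3 + y) t) ≡ suc i
    grow y t i t≤ e = trans (update-other m j λ eq → absurd (trans (sym vacant) (trans (cong m (sym eq)) e))) e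
      where
      absurd : 0 ≢ suc i
      absurd ()

  -- One iteration of the loop.

  -- No write produces `blank`: a closing parenthesis is encoded by 0, which is also the output
  -- wanted at its position.
  record Closed (r m : ℕ → ℕ) (p d j s : ℕ) : Set where
    field
      {r′ m′} : ℕ → ℕ
      reach   : Reach (state 6 r m) 12 (state 6 r′ m′)
      regs    : Regs r′ p (suc d) (suc j) 0
      inv     : Inv m′ p (suc j)
      frame   : Frame p d m m′
      pushed  : m′ (cell 2 d) ≡ s
      blank   : m′ p ≡ 0

  -- The bound `d + suc p ≤ L` says that the stack is no higher than the number of tokens read, so
  -- it fits into its row.
  closing-step : ∀ {r m p d j s} → Regs r (suc p) d j s → Inv m (suc p) j → d + suc p ≤ L →
                 input p ≡ 0 → Closed r m p d j s
  closing-step {r} {m} {p} {d} {j} {s} R I dp e =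
    let r₁ , reach₁ , R₁ , e₈ = run-prefix R
        r₂ , reach₂ , R₂ = run-closing R₁ (trans e₈ token)
    in record
      { reach  = Reach-trans reach₁ reach₂
      ; regs   = R₂
      ; inv    = push-Inv d≤L I₁
      ; frame  = Frame-trans (tableEntry-Frame (Inv.j≤L I₁) d≤L) (push-Frame d≤L)
      ; pushed = update-same m₁ (cell 2 d) s
      ; blank  = trans (other-row m₁ 2 0 s d≤L (<⇒≤ p<L) λ ()) token }
    where
    m₁ : ℕ → ℕ
    m₁ = tableEntry (suc j) m
    I₁ : Inv m₁ p (suc j)
    I₁ = tableEntry-Inv I
    d≤L : d ≤ L
    d≤L = ≤-trans (m≤m+n d _) dp
    p<L : p < L
    p<L = ≤-trans (m≤n+m (suc p) d) dp
    token : m₁ p ≡ 0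
    token = trans (other-row m 1 0 _ (Inv.j≤L I₁) (<⇒≤ p<L) λ ())
              (trans (Inv.unread I p (n<1+n p)) e)

  record Opened (r m : ℕ → ℕ) (p d j s : ℕ) (f : Forest) : Set where
    field
      {τ s′}  : ℕ
      {r′ m′} : ℕ → ℕ
      time    : τ ≤ 19
      reach   : Reach (state 6 r m) τ (state 6 r′ m′)
      regs    : Regs r′ p d (suc j) s′
      inv     : Inv m′ p (suc j)
      frame   : Frame (suc p) d m m′
      written : m′ p ≡ s
      class   : Den m′ s′ f

  -- `s` is the class of the children just read, `t` that of the forest to the right, saved at the
  -- matching closing parenthesis.
  opening-step : ∀ {r m p d j s t f g} → Regs r (suc p) (suc d) j s → Inv m (suc p) j →
    suc d + suc p ≤ L → input p ≡ 1 → Den m s f → m (cell 2 d) ≡ t → Den m t g →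
    Opened r m p d j s (f ◃ g)
  opening-step {r} {m} {p} {d} {j} {s} {t} {f} {g} R I dp e Ds eₜ Dt
    with run-prefix {m = m} R
  ... | r₁ , reach₁ , R₁ , e₈ = conclude (m₂ (cell (3 + s) t)) refl
    where
    m₁ m₂ : ℕ → ℕ
    m₁ = tableEntry (suc j) m
    m₂ = m₁ [ p ≔ s ]
    I₁ : Inv m₁ p (suc j)
    I₁ = tableEntry-Inv I
    I₂ : Inv m₂ p (suc j)
    I₂ = write-Inv I₁
    d≤L : d ≤ L
    d≤L = ≤-trans (n≤1+n d) (≤-trans (m≤m+n (suc d) _) dp)
    p<L : p < L
    p<L = ≤-trans (m≤n+m (suc p) (suc d)) dp
    p≤L : p ≤ L
    p≤L = <⇒≤ p<L
    s≤j : s ≤ j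
    s≤j = Den-≤ I Ds
    s≤L : s ≤ L
    s≤L = ≤-trans s≤j (Inv.j≤L I)
    t≤L : t ≤ L
    t≤L = ≤-trans (Den-≤ I Dt) (Inv.j≤L I)
    -- Height `suc d` covers the stack cell `d`, which is popped only after these writes.
    F₂ : Frame (suc p) (suc d) m m₂
    F₂ = Frame-trans (tableEntry-Frame (Inv.j≤L I₁) (≤-trans (m≤m+n (suc d) _) dp))
                     (write-Frame p≤L (≤-trans (m≤m+n (suc d) _) dp))
    F₂′ : Frame (suc p) d m m₂
    F₂′ = Frame-weaken ≤-refl (n≤1+n d) F₂
    token : m₁ p ≡ 1
    token = trans (other-row m 1 0 _ (Inv.j≤L I₁) p≤L λ ()) (trans (Inv.unread I p (n<1+n p)) e)
    module O = Opening {m = m₁} R₁ (trans e₈ token)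
      (Inv.table I₂ s (m≤n⇒m≤1+n s≤j)) (trans (Frame.stack F₂ d (n<1+n d)) eₜ)
    -- Entries were at most `j` before this iteration, and neither write touches the table.
    new : ∀ y u → u ≤ L → m₂ (cell (3 + y) u) < suc j
    new y u u≤ = s≤s (subst (_≤ j)
      (sym (trans (other-row m₁ 0 (3 + y) s p≤L u≤ λ ())
                  (other-row m 1 (3 + y) _ (Inv.j≤L I₁) u≤ λ ())))
      (Inv.trie-≤ I y u u≤))
    conclude : ∀ v → m₂ (cell (3 + s) t) ≡ v → Opened r m p d j s (f ◃ g)
    conclude (suc i) known = let r₂ , reach₂ , R₂ = O.run-known known in record
      -- A known pair costs 7 + 9 = 16 instructions, a new one 7 + 12 = 19.
      { time    = m≤m+n 16 3
      ; reach   = Reach-trans reach₁ reach₂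
      ; regs    = R₂
      ; inv     = I₂
      ; frame   = F₂′
      ; written = update-same m₁ p s
      ; class   = den-◃ {x = s} t≤L known (Den-mono F₂ Ds) (Den-mono F₂ Dt) }
    conclude zero vacant = let r₂ , reach₂ , R₂ = O.run-new vacant in record
      { time    = ≤-refl
      ; reach   = Reach-trans reach₁ reach₂
      ; regs    = R₂
      ; inv     = insert-Inv {x = s} t≤L new I₂
      ; frame   = F₃
      ; written = trans (other-row m₂ (3 + s) 0 (suc j) t≤L p≤L λ ()) (update-same m₁ p s)
      ; class   = den-◃ {x = s} t≤L (update-same m₂ (cell (3 + s) t) (suc j)) (Den-mono F₃ Ds) (Den-mono F₃ Dt) }
      where
      F₃ : Frame (suc p) d m (m₂ [ cell (3 + s) t ≔ suc j ])
      F₃ = Frame-trans F₂′ (insert-Frame {x = s} t≤L d≤L vacant)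

  -- Processing a whole forest, with its running time.

  -- `g` is the forest right of `f`, already read. `time` charges at most 19 instructions to each
  -- parenthesis of `f`, written without subtraction.
  record Processed (f g : Forest) (a d : ℕ) (r m : ℕ → ℕ) : Set where
    field
      {τ}     : ℕ
      {r′ m′} : ℕ → ℕ
      {j s}   : ℕ
      reach   : Reach (state 6 r m) τ (state 6 r′ m′)
      time    : τ + 19 * a ≤ 19 * end f a
      regs    : Regs r′ a d j s
      inv     : Inv m′ a j
      class   : Den m′ s (f ⊕ g)
      frame   : Frame (end f a) d m m′
      out     : ∀ {q x} → At f a q x → Den m′ (m′ q) x
      gap     : ∀ q → a ≤ q → q < end f a → m′ q ≡ 0 ⊎ (∃[ x ] At f a q x)

  -- The summands belong to the later siblings (`u`), the closing parenthesis (12), the children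
  -- (`v`) and the opening parenthesis (`w`).
  time-◃ : ∀ u v {w a b e} → w ≤ 19 → v + 19 * suc a ≤ 19 * b → u + 19 * suc b ≤ e →
           (u + (12 + (v + w))) + 19 * a ≤ e
  time-◃ u v {w} {a} {b} {e} w≤ v≤ u≤ = begin
    (u + (12 + (v + w))) + 19 * a
      ≡⟨ solve 4 (λ u v w y → (u :+ (con 12 :+ (v :+ w))) :+ y := u :+ (con 12 :+ (v :+ (w :+ y))))
           refl u v w (19 * a) ⟩
    u + (12 + (v + (w + 19 * a)))
      ≤⟨ +-monoʳ-≤ u (+-mono-≤ (m≤m+n 12 7) (+-monoʳ-≤ v (+-monoˡ-≤ (19 * a) w≤))) ⟩
    u + (19 + (v + (19 + 19 * a)))
      ≡⟨ cong (λ i → u + (19 + (v + i))) (sym (*-suc 19 a)) ⟩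
    u + (19 + (v + 19 * suc a))
      ≤⟨ +-monoʳ-≤ u (+-monoʳ-≤ 19 v≤) ⟩
    u + (19 + 19 * b)
      ≡⟨ cong (u +_) (sym (*-suc 19 b)) ⟩
    u + 19 * suc b
      ≤⟨ u≤ ⟩
    e ∎
    where
    open ≤-Reasoning
    open +-*-Solver

  Processed-◃ : ∀ {f g x a d r m} → d + end (x ◃ f) a ≤ L →
    (pf : Processed f g (end (x ◃ ε) a) d r m) → let module F = Processed pf in
    (cl : Closed F.r′ F.m′ (end x (suc a)) d F.j F.s) → let module C = Closed cl in
    (px : Processed x ε (suc a) (suc d) C.r′ C.m′) → let module X = Processed px in
    Opened X.r′ X.m′ a d X.j X.s ((x ⊕ ε) ◃ (f ⊕ g)) → Processed (x ◃ f) g a d r m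
  Processed-◃ {f} {g} {x} {a} {d} l pf cl px op = record
    { reach = Reach-trans F.reach (Reach-trans C.reach (Reach-trans X.reach O.reach))
    ; time  = time
    ; regs  = O.regs
    ; inv   = O.inv
    ; class = subst (λ y → Den O.m′ O.s′ (y ◃ (f ⊕ g))) (⊕-identityʳ x) O.class
    ; frame = Frame-trans F.frame (Frame-weaken (end-≤ f _) ≤-refl F₄)
    ; out   = out
    ; gap   = gap }
    where
    b c : ℕ
    b = end x (suc a)
    c = suc b
    module F = Processed pf
    module C = Closed cl
    module X = Processed px
    module O = Opened op
    F₂ : Frame b d C.m′ O.m′
    F₂ = Frame-trans (Frame-weaken ≤-refl (n≤1+n d) X.frame) (Frame-weaken (end-≤ x (suc a)) ≤-refl O.frame)
    F₄ : Frame c d F.m′ O.m′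
    F₄ = Frame-weaken (n≤1+n b) ≤-refl (Frame-trans C.frame F₂)
    end≤L : end f c ≤ L
    end≤L = ≤-trans (m≤n+m _ d) l
    b≤end : b ≤ end f c
    b≤end = ≤-trans (n≤1+n b) (end-≤ f c)
    outF : ∀ {q} → c ≤ q → q < end f c → O.m′ q ≡ F.m′ q
    outF c≤q q< = Frame.done F₄ _ c≤q (≤-trans (<⇒≤ q<) end≤L)
    outX : ∀ {q} → suc a ≤ q → q < b → O.m′ q ≡ X.m′ q
    outX a<q q<b = Frame.done O.frame _ a<q (≤-trans (<⇒≤ q<b) (≤-trans b≤end end≤L))
    out : ∀ {q y} → At (x ◃ f) a q y → Den O.m′ (O.m′ q) y
    out here       = subst (λ i → Den O.m′ i x) (sym O.written)
                       (Den-mono O.frame (subst (Den X.m′ X.s) (⊕-identityʳ x) X.class))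
    out (inside q) = subst (λ i → Den O.m′ i _) (sym (outX (At-≥ q) (At-< q))) (Den-mono O.frame (X.out q))
    out (after q)  = subst (λ i → Den O.m′ i _) (sym (outF (At-≥ q) (At-< q))) (Den-mono F₄ (F.out q))
    gap : ∀ q → a ≤ q → q < end f c → O.m′ q ≡ 0 ⊎ (∃[ y ] At (x ◃ f) a q y)
    -- The opening parenthesis is at `a` and its partner at `b`; the children lie between them, the
    -- siblings beyond.
    gap q a≤q q< with m≤n⇒m<n∨m≡n a≤q
    ... | inj₂ refl = inj₂ (x , here)
    ... | inj₁ a<q with <-cmp q b
    ...   | tri≈ _ refl _ = inj₁ (trans (Frame.done F₂ b ≤-refl (≤-trans b≤end end≤L)) C.blank)
    ...   | tri< q<b _ _ with X.gap q a<q q<b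
    ...     | inj₁ e       = inj₁ (trans (outX a<q q<b) e)
    ...     | inj₂ (y , p) = inj₂ (y , inside p)
    gap q a≤q q< | inj₁ a<q | tri> _ _ b<q with F.gap q b<q q<
    ...     | inj₁ e       = inj₁ (trans (outF b<q q<) e)
    ...     | inj₂ (y , p) = inj₂ (y , after p)
    time : (F.τ + (12 + (X.τ + O.τ))) + 19 * a ≤ 19 * end f c
    time = time-◃ F.τ X.τ O.time X.time F.time

  -- Arbitrary `g` and `d` let the induction treat both the siblings, with the same `g` and `d`, and
  -- the children, with `ε` and `suc d`.
  process : ∀ f {g zs a d j s r m} → Holds input a (render f zs) → Regs r (end f a) d j s →
            Inv m (end f a) j → Den m s g → d + end f a ≤ L → Processed f g a d r m
  process ε h R I D _ = record
    { τ = 0 ; reach = via λ Q → Q ; time = ≤-refl ; regs = R ; inv = I ; class = D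
    ; frame = Frame-refl ; out = λ () ; gap = λ q a≤q q<a → ⊥-elim (<⇒≱ q<a a≤q) }
  process (x ◃ f) {a = a} {d} (hₒ , h) R I D l =
    Processed-◃ l pf cl px (opening-step X.regs X.inv da hₒ X.class
      -- The class pushed at the closing parenthesis survives the children, which use only the stack
      -- above it.
      (trans (Frame.stack X.frame d (n<1+n d)) C.pushed) (Den-mono X.frame (Den-mono C.frame F.class)))
    where
    h′ = Holds-end x h
    pf = process f {a = suc (end x (suc a))} {d = d} (proj₂ h′) R I D l
    module F = Processed pf
    dc : d + suc (end x (suc a)) ≤ L
    dc = ≤-trans (+-monoʳ-≤ d (end-≤ f _)) l
    dx : suc d + end x (suc a) ≤ L
    dx = ≤-trans (≤-reflexive (sym (+-suc d _))) dc
    da : suc d + suc a ≤ L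
    da = ≤-trans (+-monoʳ-≤ (suc d) (end-≤ x (suc a))) dx
    cl = closing-step F.regs F.inv dc (proj₁ h′)
    module C = Closed cl
    px = process x {a = suc a} {d = suc d} h C.regs C.inv den-ε dx
    module X = Processed px

-- k²-trees as forests

forest : ∀ {n} → (Fin n → Forest) → Forest
forest {zero}  g = ε
forest {suc n} g = g zero ◃ forest (g ∘ suc)

-- Follows `parens` rather than the tree: at index 1 the children leave no trace, so the content is
-- empty.
content : ∀ {k d} → K2Tree k d → Forest
content (entry _)                   = ε
content zeros                       = ε
content {d = suc zero}    (node ts) = ε
content {d = suc (suc _)} (node ts) = forest λ c → content (ts c)

render-forest : ∀ {n} (g : Fin n → Forest) (ps : Fin n → List Paren) →
                (∀ c ys → ps c ++ ys ≡ render (g c ◃ ε) ys) →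
                ∀ zs → concat (tabulate ps) ++ zs ≡ render (forest g) zs
render-forest {zero}  g ps e zs = refl
render-forest {suc n} g ps e zs = trans (++-assoc (ps zero) _ zs) (trans (e zero _)
  (cong (λ ys → opening ∷ render (g zero) (closing ∷ ys)) (render-forest (g ∘ suc) (ps ∘ suc) (e ∘ suc) zs)))

parens-render : ∀ {k d} (t : K2Tree k d) zs → parens t ++ zs ≡ render (content t ◃ ε) zs
parens-render (entry _) zs = refl
parens-render zeros     zs = refl
parens-render {d = suc zero}    (node ts) zs = refl
parens-render {d = suc (suc _)} (node ts) zs = cong (opening ∷_)
  (trans (++-assoc (concat (tabulate λ c → parens (ts c))) [ closing ] zs)
         (render-forest _ _ (λ c → parens-render (ts c)) (closing ∷ zs)))

parens≡render : ∀ {k d} (t : K2Tree k d) → parens t ≡ render (content t ◃ ε) []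
parens≡render t = trans (sym (++-identityʳ (parens t))) (parens-render t [])

parens-injective : ∀ {k d e} (t : K2Tree k d) (u : K2Tree k e) → parens t ≡ parens u → content t ≡ content u
parens-injective t u eq with render-unique (content t ◃ ε) (content u ◃ ε) tt tt
  (trans (sym (parens≡render t)) (trans eq (parens≡render u)))
... | e , _ = ◃-injectiveˡ e
  where
  ◃-injectiveˡ : ∀ {x y f g} → x ◃ f ≡ y ◃ g → x ≡ y
  ◃-injectiveˡ refl = refl

content⇒parens : ∀ {k d e} (t : K2Tree k d) (u : K2Tree k e) → content t ≡ content u → parens t ≡ parens u
content⇒parens t u eq =
  trans (parens≡render t) (trans (cong (λ f → render (f ◃ ε) []) eq) (sym (parens≡render u)))

end-content : ∀ {k d} (t : K2Tree k d) a → end (content t ◃ ε) a ≡ a + length (parens t)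
end-content t a = trans (sym (+-identityʳ _)) (trans (sym (length-render (content t ◃ ε) [] a))
                    (cong (λ z → a + length z) (sym (parens≡render t))))

-- The position of child c, if the first child is at position a.
start : ∀ {k d n} → (Fin n → K2Tree k d) → Fin n → ℕ → ℕ
start ts c a = a + sum (take (toℕ c) (tabulate λ i → length (parens (ts i))))

start-suc : ∀ {k d n} (ts : Fin (suc n) → K2Tree k d) (c : Fin n) a →
            start (ts ∘ suc) c (end (content (ts zero) ◃ ε) a) ≡ start ts (suc c) a
start-suc ts c a = trans (cong (λ b → start (ts ∘ suc) c b) (end-content (ts zero) a)) (+-assoc a _ _)

At-resp : ∀ {f a b p q x} → a ≡ b → p ≡ q → At f a p x → At f b q x
At-resp refl refl r = r

At-forest : ∀ {k d n} (ts : Fin n → K2Tree k d) c {a p x} → At (content (ts c) ◃ ε) (start ts c a) p x →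
            At (forest λ i → content (ts i)) a p x
At-forest ts zero {a} q with At-resp (+-identityʳ a) refl q
... | here     = here
... | inside r = inside r
At-forest ts (suc c) {a} q = after (At-forest (ts ∘ suc) c (At-resp (sym (start-suc ts c a)) refl q))

forest-At : ∀ {k d n} (ts : Fin n → K2Tree k d) {a p x} → At (forest λ i → content (ts i)) a p x →
            ∃[ c ] At (content (ts c) ◃ ε) (start ts c a) p x
forest-At {n = suc n} ts {a} here       = zero , At-resp (sym (+-identityʳ a)) refl here
forest-At {n = suc n} ts {a} (inside q) = zero , At-resp (sym (+-identityʳ a)) refl (inside q)
forest-At {n = suc n} ts {a} (after q)  =
  let c , r = forest-At (ts ∘ suc) q in suc c , At-resp (start-suc ts c a) refl r

position-child : ∀ {k d} (ts : Fin (k * k) → K2Tree k (suc d)) c (u : Node (ts c)) a →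
                 start ts c (suc a) + position u ≡ a + position (child {ts = ts} c u)
position-child ts c u a = trans (+-assoc (suc a) _ (position u)) (sym (+-suc a _))

At-position : ∀ {k d} {t : K2Tree k d} (u : Node t) a →
              At (content t ◃ ε) a (a + position u) (content (subtree u))
At-position root a = At-resp refl (sym (+-identityʳ a)) here
At-position (child {ts = ts} c u) a =
  inside (At-forest ts c (At-resp refl (position-child ts c u a) (At-position u (start ts c (suc a)))))

-- Converse of `At-position`: every opening parenthesis belongs to a node, so the output array can
-- be read as a labelling of subtrees.
position-At : ∀ {k d} (t : K2Tree k d) {a p x} → At (content t ◃ ε) a p x →
              ∃[ u ] p ≡ a + position {t = t} u × content (subtree u) ≡ x
position-At t here = root , sym (+-identityʳ _) , refl
position-At (entry _) (inside ())
position-At zeros     (inside ())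
position-At {d = suc zero} (node ts) (inside ())
position-At {d = suc (suc _)} (node ts) {a} (inside q) =
  let c , q′     = forest-At ts q
      u , p≡ , e = position-At (ts c) q′
  in  child c u , trans p≡ (position-child ts c u a) , e

-- Height greater than 1 versus nonempty content.

height>1⇒content≢ε : ∀ {k d} (t : K2Tree k d) → 1 < height t → content t ≢ ε
height>1⇒content≢ε {k} {suc (suc d)} (node ts) (s≤s h) e with k * k
-- With `k = 0` there are no children, so the height is 1.
... | zero  = <⇒≱ h z≤n
height>1⇒content≢ε {d = suc (suc d)} (node ts) (s≤s h) () | suc n
height>1⇒content≢ε {d = suc zero} (node ts) (s≤s h) e = <⇒≱ h (flat ts)
  where
  flat : ∀ {n k} (ts : Fin n → K2Tree k 0) → foldr _⊔_ 0 (tabulate λ c → height (ts c)) ≤ 0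
  flat {zero}  ts = z≤n
  flat {suc n} ts with ts zero
  ... | entry _ = flat (ts ∘ suc)

height-child : ∀ {k d n} (ts : Fin n → K2Tree k d) c →
               height (ts c) ≤ foldr _⊔_ 0 (tabulate λ i → height (ts i))
height-child ts zero    = m≤m⊔n _ _
height-child ts (suc c) = ≤-trans (height-child (ts ∘ suc) c) (m≤n⊔m _ _)

height-build : ∀ k d (M : Matrix (k ^ suc d)) → ¬ AllZero M → 0 < height (build k (suc d) M)
height-build k d M nz with allZero? M
... | yes z = ⊥-elim (nz z)
... | no _  = s≤s z≤n

-- Every entry lies in some block, so zero blocks would make the matrix zero; the witness is found
-- by a finite decidable search.
nonzero-block : ∀ k {m} (M : Matrix (k * m)) → ¬ AllZero M →
  ∃[ c ] ¬ AllZero (block k M (proj₁ (remQuot {k} k c)) (proj₂ (remQuot {k} k c)))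
nonzero-block k {m} M nz = Fin.¬∀⟶∃¬ (k * k) _ (λ c → allZero? _) λ z → nz (zero-everywhere z)
  where
  zero-everywhere :
    (∀ c → AllZero (block k M (proj₁ (remQuot {k} k c)) (proj₂ (remQuot {k} k c)))) → AllZero M
  zero-everywhere z i j = begin
    M i j              ≡⟨ cong₂ M (Fin.combine-remQuot {k} m i) (Fin.combine-remQuot {k} m j) ⟨
    block k M r c x y  ≡⟨ cong (λ rc → block k M (proj₁ rc) (proj₂ rc) x y) (Fin.remQuot-combine r c) ⟨
    _                  ≡⟨ z (combine r c) x y ⟩
    false              ∎
    where
    open ≡-Reasoning
    r c : Fin k
    r = proj₁ (remQuot {k} m i)
    c = proj₁ (remQuot {k} m j)
    x y : Fin m
    x = proj₂ (remQuot {k} m i)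
    y = proj₂ (remQuot {k} m j)

-- This is special to trees made by `build`: a `node` with only `zeros` as children could have
-- nonempty content and height 1. Here an internal node has a nonzero block, hence an internal
-- child.
content≢ε⇒height>1 : ∀ k d (M : Matrix (k ^ d)) (u : Node (build k d M)) →
                     content (subtree u) ≢ ε → 1 < height (subtree u)
content≢ε⇒height>1 k zero    M root ne = ⊥-elim (ne refl)
content≢ε⇒height>1 k (suc d) M u ne with allZero? M
content≢ε⇒height>1 k (suc d) M root ne | yes _ = ⊥-elim (ne refl)
content≢ε⇒height>1 k (suc zero) M root ne | no _ = ⊥-elim (ne refl)
content≢ε⇒height>1 k (suc (suc d)) M root ne | no nz with nonzero-block k M nz
... | c , nz′ = s≤s (≤-trans (height-build k d _ nz′) (height-child {k} _ c))
content≢ε⇒height>1 k (suc (suc d)) M (child c u) ne | no _ = content≢ε⇒height>1 k (suc d) _ u ne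

-- From the final memory to the classes of subtrees.

-- D i f: the trees whose root has the children f belong to class i.
record Classifies (f : Forest) (L : ℕ) (o : ℕ → ℕ) : Set₁ where
  field
    D             : ℕ → Forest → Set
    empty         : D 0 ε
    forest-unique : ∀ {i g h} → D i g → D i h → g ≡ h
    class-unique  : ∀ {i j g} → D i g → D j g → i ≡ j
    bounded       : ∀ {i g} → D i g → i ≤ L
    out           : ∀ {p g} → At f 0 p g → D (o p) g
    gap           : ∀ p → p < L → o p ≡ 0 ⊎ (∃[ g ] At f 0 p g)

prog-classifies : ∀ k n f B → B ≡ render f [] →
  ∃[ time ] ∃[ s ] Runs prog (initial k n B) time s × time ≤ 8 + 19 * length B
                 × Classifies f (length B) (output s)
-- Six instructions set up the registers and the first row address; two leave the loop.
prog-classifies k n f B B≡ = 6 + (P.τ + 2) , final , run , time≤ , record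
  { D             = Den P.m′
  ; empty         = den-ε
  ; forest-unique = Den-forest-unique P.inv
  ; class-unique  = Den-class-unique
  ; bounded       = λ D → ≤-trans (Den-≤ P.inv D) (Inv.j≤L P.inv)
  ; out           = λ {p} q → subst (λ i → Den P.m′ i _) (sym (out≡ p)) (P.out q)
  ; gap           = gap }
  where
  L : ℕ
  L = length B
  open Machine L (inputMem B)

  end≡L : end f 0 ≡ L
  end≡L = trans (sym (+-identityʳ _)) (trans (sym (length-render f [] 0)) (cong length (sym B≡)))

  r : ℕ → ℕ
  r = inputRegs k n B [ 0 ≔ 0 ] [ 1 ≔ 1 ] [ 3 ≔ L + 1 ] [ 5 ≔ (L + 1) + (L + 1) ]
        [ 4 ≔ ((L + 1) + (L + 1)) + (L + 1) ]
  m : ℕ → ℕ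
  m = tableEntry 0 (inputMem B)

  L+1≡S : L + 1 ≡ S
  L+1≡S = +-comm L 1
  5≡ : (L + 1) + (L + 1) ≡ cell 2 0
  5≡ = cong₂ _+_ L+1≡S (trans L+1≡S (sym (+-identityʳ S)))
  4≡ : ((L + 1) + (L + 1)) + (L + 1) ≡ cell 3 0
  4≡ = trans (cong₂ _+_ 5≡ L+1≡S) (+-comm (cell 2 0) S)

  regs : Regs r L 0 0 0
  regs = record
    { r₀ = refl ; r₁ = refl ; r₂ = refl ; r₃ = L+1≡S ; r₄ = 4≡ ; r₅ = 5≡ ; r₆ = refl ; r₇ = refl }

  prelude : Reach (initial k n B) 6 (state 6 r m)
  prelude = via λ {i} {z} Q → step refl (step refl (step refl (step refl (step refl (step refl
    (subst (λ g → Runs prog (state 6 r g) i z)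
      (sym (cong₂ (λ a v → inputMem B [ a ≔ v ]) (trans L+1≡S (sym (+-identityʳ S))) 4≡)) Q))))))

  -- The table has quadratic size and is never initialised; its cells lie beyond the input and are
  -- therefore 0.
  vacant : ∀ x s → s ≤ L → m (cell (3 + x) s) ≡ 0
  vacant x s s≤ = trans (other-row (inputMem B) 1 (3 + x) _ z≤n s≤ λ ())
    (inputMem-≥ B (≤-trans (n≤1+n L) (m≤m+n S _)))

  inv : Inv m L 0
  inv = record
    { count    = refl
    ; table    = λ { zero z≤n → update-same (inputMem B) _ _ }
    ; unread   = λ q q<L → other-row (inputMem B) 1 0 _ z≤n (<⇒≤ q<L) λ ()
    ; trie-≤   = λ x s s≤ → ≤-reflexive (vacant x s s≤)
    ; trie-inj = λ x s _ _ s≤ _ e → ⊥-elim (0≢1+n (trans (sym (vacant x s s≤)) e)) }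

  module P = Processed (process f {ε} {[]} {0} {0}
    (subst (Holds (inputMem B) 0) B≡ (inputMem-Holds B))
    (subst (λ e → Regs r e 0 0 0) (sym end≡L) regs)
    (subst (λ e → Inv m e 0) (sym end≡L) inv)
    den-ε (≤-reflexive end≡L))

  final : State
  final = state 30 P.r′ P.m′

  run : Runs prog (initial k n B) (6 + (P.τ + 2)) final
  run = extend prelude (extend P.reach
    (step-jpos-zero refl (Regs.r₂ P.regs) (step refl (stop refl))))

  time≤ : 6 + (P.τ + 2) ≤ 8 + 19 * L
  time≤ = ≤-trans (≤-reflexive (cong (6 +_) (+-comm P.τ 2)))
    (+-monoʳ-≤ 8 (≤-trans (m≤m+n P.τ 0) (subst (λ e → P.τ + 0 ≤ 19 * e) end≡L P.time)))

  out≡ : ∀ p → output final p ≡ P.m′ p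
  out≡ p = cong (λ a → P.m′ (a + p)) (Regs.r₀ P.regs)

  gap : ∀ p → p < L → output final p ≡ 0 ⊎ (∃[ g ] At f 0 p g)
  gap p p<L with P.gap p z≤n (subst (p <_) (sym end≡L) p<L)
  ... | inj₁ e = inj₁ (trans (out≡ p) e)
  ... | inj₂ q = inj₂ q

-- Only `ε` has class 0, so the marked positions are those of nodes with nonempty content; `tall`
-- and `height>1⇒content≢ε` translate this into height.
Classifies⇒DescribesClasses : ∀ {k d} (t : K2Tree k d) {o} →
  (∀ (u : Node t) → content (subtree u) ≢ ε → 1 < height (subtree u)) →
  Classifies (content t ◃ ε) (length (parens t)) o → DescribesClasses t o
Classifies⇒DescribesClasses t {o} tall C =
  record { marks = λ p p<L → mk⇔ (to p p<L) from ; bounded = bounded′ ; classes = classes }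
  where
  open Classifies C

  class : ∀ (u : Node t) → D (o (position u)) (content (subtree u))
  class u = out (At-position u 0)

  node-at : ∀ p → p < length (parens t) → o p ≡ 0 ⊎ (∃[ u ] position {t = t} u ≡ p)
  node-at p p<L with gap p p<L
  ... | inj₁ e       = inj₁ e
  ... | inj₂ (_ , q) = let u , p≡ , _ = position-At t q in inj₂ (u , sym p≡)

  to : ∀ p → p < length (parens t) → 0 < o p → ∃[ u ] 1 < height (subtree {t = t} u) × position u ≡ p
  to p p<L pos with node-at p p<L
  ... | inj₁ e          = ⊥-elim (>⇒≢ pos e)
  ... | inj₂ (u , refl) = u , tall u (λ e → >⇒≢ pos (class-unique (subst (D _) e (class u)) empty)) , refl

  from : ∀ {p} → (∃[ u ] 1 < height (subtree {t = t} u) × position u ≡ p) → 0 < o p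
  from (u , h , refl) = n≢0⇒n>0 λ e → height>1⇒content≢ε (subtree u) h
    (forest-unique (subst (λ i → D i _) e (class u)) empty)

  bounded′ : ∀ p → p < length (parens t) → o p ≤ length (parens t)
  bounded′ p p<L with node-at p p<L
  ... | inj₁ e          = subst (_≤ _) (sym e) z≤n
  ... | inj₂ (u , refl) = bounded (class u)

  classes : ∀ (u v : Node t) → 1 < height (subtree u) → 1 < height (subtree v) →
            o (position u) ≡ o (position v) ⇔ Interchangeable (subtree u) (subtree v)
  classes u v hᵤ hᵥ = mk⇔
    (λ e → hᵤ , hᵥ , content⇒parens (subtree u) (subtree v)
             (forest-unique (subst (λ i → D i _) e (class u)) (class v)))
    (λ (_ , _ , e) → class-unique
      (subst (D _) (parens-injective (subtree u) (subtree v) e) (class u)) (class v))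

2≤length-parens : ∀ {k d} (t : K2Tree k d) → 2 ≤ length (parens t)
2≤length-parens t = ≤-trans (s≤s (end-≤ (content t) 1)) (≤-reflexive (end-content t 0))

mainTheorem4 : ∃[ P ] ∃[ c ] (∀ (k n h : ℕ) → 2 ≤ k → 1 ≤ n → IsCeilLog k n h → (M : Matrix n) →
    let t = k²-tree k h M
        B = parens t
    in ∃[ time ] ∃[ s ] Runs P (initial k n B) time s × time ≤ c * length B × DescribesClasses t (output s))
-- 23 = 4 + 19: the additive constant 8 is at most 4 times the length, which is at least 2.
mainTheorem4 = prog , 23 , λ k n h _ _ _ M →
  let t = k²-tree k h M
      time , s , run , time≤ , C = prog-classifies k n (content t ◃ ε) (parens t) (parens≡render t)
  in  time , s , run
    , ≤-trans time≤ (≤-trans (+-monoˡ-≤ _ (*-monoʳ-≤ 4 (2≤length-parens t)))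
                             (≤-reflexive (sym (*-distribʳ-+ (length (parens t)) 4 19))))
    , Classifies⇒DescribesClasses t (content≢ε⇒height>1 k h (pad M)) C
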